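{- The number $\displaystyle\sum_{n=1}^{\infty}\frac{1}{p_n!}$ is irrational, where $p_n$ denotes the $n$-th prime. -}

module Defs where

open import Data.Empty using (⊥-elim)
open import Data.Integer.Base using (+_)
open import Data.List.Base using ([]; _∷_)
open import Data.List.Relation.Unary.All using (_∷_)
open import Data.Nat.Base as ℕ using (ℕ; zero; suc; _!; z≤n; s≤s)
import Data.Nat.Properties as ℕ
open import Data.Nat.ListAction using (product)
open import Data.Nat.Divisibility using (_∣_; ∣-trans; m∣m*n; m≤n⇒m!∣n!; ∣m+n∣m⇒∣n; ∣1⇒≡1)
open import Data.Nat.Primality using (Prime; prime?; ¬prime[0]; ¬prime[1])
open import Data.Nat.Primality.Factorisation using (PrimeFactorisation; factorise)
open import Data.Product.Base using (∃; ∃-syntax; _×_; _,_; proj₁; proj₂)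
open import Data.Rational.Base as ℚ using (ℚ; 0ℚ; ½)
import Data.Rational.Properties as ℚ
open import Data.Rational.Solver using (module +-*-Solver)
open import Data.Sum.Base using (inj₁; inj₂)
open import Relation.Binary.PropositionalEquality
open import Relation.Nullary using (¬_; yes; no)

IsNextPrime : ℕ → ℕ → Set
IsNextPrime m p = m ℕ.< p × Prime p × (∀ q → m ℕ.< q → Prime q → p ℕ.≤ q)

-- Euclid: any prime factor of m ! + 1 exceeds m.
primeAbove : ∀ m → ∃[ p ] m ℕ.< p × Prime p
primeAbove m with factorise (suc (m !))
... | record { factors = [] ; isFactorisation = eq } =
  ⊥-elim (ℕ.<⇒≢ (ℕ.1≤n! m) (sym (ℕ.suc-injective eq)))
... | record { factors = p ∷ ps ; isFactorisation = eq ; factorsPrime = pp ∷ _ } =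
  p , ℕ.≰⇒> (λ p≤m → p∤1 (∣m+n∣m⇒∣n p∣m!+1 (p∣m! p pp p≤m))) , pp
  where
  p∣m!+1 : p ∣ m ! ℕ.+ 1
  p∣m!+1 = subst (p ∣_) (trans (sym eq) (ℕ.+-comm 1 (m !))) (m∣m*n (product ps))

  p∤1 : ¬ p ∣ 1
  p∤1 p∣1 = ¬prime[1] (subst Prime (∣1⇒≡1 p∣1) pp)

  p∣m! : ∀ p → Prime p → p ℕ.≤ m → p ∣ m !
  p∣m! zero    p-prime _   = ⊥-elim (¬prime[0] p-prime)
  p∣m! (suc k) _       p≤m = ∣-trans (m∣m*n (k !)) (m≤n⇒m!∣n! p≤m)

leastPrimeFrom : ∀ d m → Prime (d ℕ.+ suc m) → ∃ (IsNextPrime m)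
leastPrimeFrom d m pr with prime? (suc m)
leastPrimeFrom d       m pr | yes p = suc m , ℕ.≤-refl , p , λ q m<q _ → m<q
leastPrimeFrom zero    m pr | no ¬p = ⊥-elim (¬p pr)
leastPrimeFrom (suc d) m pr | no ¬p
  with leastPrimeFrom d (suc m) (subst Prime (sym (ℕ.+-suc d (suc m))) pr)
... | p , m+1<p , p-prime , least = p , ℕ.<-trans (ℕ.n<1+n m) m+1<p , p-prime , least′
  where
  least′ : ∀ q → m ℕ.< q → Prime q → p ℕ.≤ q
  least′ q m<q q-prime with ℕ.m≤n⇒m<n∨m≡n m<q
  ... | inj₁ m+1<q = least q m+1<q q-prime
  ... | inj₂ refl  = ⊥-elim (¬p q-prime)

nextPrime : ∀ m → ∃ (IsNextPrime m)
nextPrime m with primeAbove m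
... | p , m<p , p-prime =
  leastPrimeFrom (p ℕ.∸ suc m) m (subst Prime (sym (ℕ.m∸n+n≡m m<p)) p-prime)

-- Indexed from 0: nthPrime 0 = 2, nthPrime 1 = 3, nthPrime 2 = 5, …
nthPrime : ℕ → ℕ
nthPrime zero    = proj₁ (nextPrime 0)
nthPrime (suc n) = proj₁ (nextPrime (nthPrime n))

1/_! : ℕ → ℚ
1/ n ! = (+ 1) ℚ./ (n !)
  where instance _ = n ℕ.!≢0

IsCauchy : (ℕ → ℚ) → Set
IsCauchy a = ∀ {ε} → 0ℚ ℚ.< ε →
  ∃[ N ] ∀ m n → N ℕ.≤ m → N ℕ.≤ n → ℚ.∣ a m ℚ.- a n ∣ ℚ.< ε

-- Equality of reals is _≃_ below, not propositional equality of sequences.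
record ℝ : Set where
  constructor mkℝ
  field
    seq    : ℕ → ℚ
    cauchy : IsCauchy seq

open ℝ public

infix  4 _≃_ _<_
infixl 6 _+_ _-_
infix  8 -_

_≃_ : ℝ → ℝ → Set
x ≃ y = ∀ ε → 0ℚ ℚ.< ε → ∃[ N ] ∀ n → N ℕ.≤ n → ℚ.∣ seq x n ℚ.- seq y n ∣ ℚ.< ε

_<_ : ℝ → ℝ → Set
x < y = ∃[ δ ] 0ℚ ℚ.< δ × ∃[ N ] ∀ n → N ℕ.≤ n → seq x n ℚ.+ δ ℚ.< seq y n

fromℚ : ℚ → ℝ
fromℚ q = mkℝ (λ _ → q)
  λ 0<ε → 0 , λ _ _ _ _ → subst (ℚ._< _) (sym (cong ℚ.∣_∣ (ℚ.+-inverseʳ q))) 0<ε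

0ℝ : ℝ
0ℝ = fromℚ 0ℚ

_+_ : ℝ → ℝ → ℝ
x + y = mkℝ (λ n → seq x n ℚ.+ seq y n) +-cauchy
  where
  rearrange : ∀ a b c d → (a ℚ.+ b) ℚ.- (c ℚ.+ d) ≡ (a ℚ.- c) ℚ.+ (b ℚ.- d)
  rearrange = solve 4 (λ a b c d → (a :+ b) :- (c :+ d) := (a :- c) :+ (b :- d)) refl
    where open +-*-Solver

  halves : ∀ ε → ½ ℚ.* ε ℚ.+ ½ ℚ.* ε ≡ ε
  halves ε = trans (sym (ℚ.*-distribʳ-+ ε ½ ½)) (ℚ.*-identityˡ ε)

  +-cauchy : IsCauchy (λ n → seq x n ℚ.+ seq y n)
  +-cauchy {ε} 0<ε = M ℕ.⊔ N , λ m n h k → begin-strict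
      ℚ.∣ (seq x m ℚ.+ seq y m) ℚ.- (seq x n ℚ.+ seq y n) ∣
        ≡⟨ cong ℚ.∣_∣ (rearrange (seq x m) (seq y m) (seq x n) (seq y n)) ⟩
      ℚ.∣ (seq x m ℚ.- seq x n) ℚ.+ (seq y m ℚ.- seq y n) ∣
        ≤⟨ ℚ.∣p+q∣≤∣p∣+∣q∣ (seq x m ℚ.- seq x n) (seq y m ℚ.- seq y n) ⟩
      ℚ.∣ seq x m ℚ.- seq x n ∣ ℚ.+ ℚ.∣ seq y m ℚ.- seq y n ∣
        <⟨ ℚ.+-mono-<
             (x-close m n (ℕ.m⊔n≤o⇒m≤o M N h) (ℕ.m⊔n≤o⇒m≤o M N k))
             (y-close m n (ℕ.m⊔n≤o⇒n≤o M N h) (ℕ.m⊔n≤o⇒n≤o M N k)) ⟩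
      ½ ℚ.* ε ℚ.+ ½ ℚ.* ε
        ≡⟨ halves ε ⟩
      ε ∎
    where
    open ℚ.≤-Reasoning
    0<½ε : 0ℚ ℚ.< ½ ℚ.* ε
    0<½ε = subst (ℚ._< ½ ℚ.* ε) (ℚ.*-zeroʳ ½) (ℚ.*-monoʳ-<-pos ½ 0<ε)
    M = proj₁ (cauchy x 0<½ε)
    N = proj₁ (cauchy y 0<½ε)
    x-close = proj₂ (cauchy x 0<½ε)
    y-close = proj₂ (cauchy y 0<½ε)

-_ : ℝ → ℝ
- x = mkℝ (λ n → ℚ.- seq x n) λ 0<ε →
  proj₁ (cauchy x 0<ε) , λ m n h k →
    subst (ℚ._< _) (sym (∣-a--b∣ (seq x m) (seq x n))) (proj₂ (cauchy x 0<ε) m n h k)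
  where
  ∣-a--b∣ : ∀ a b → ℚ.∣ ℚ.- a ℚ.- ℚ.- b ∣ ≡ ℚ.∣ a ℚ.- b ∣
  ∣-a--b∣ a b =
    trans (cong ℚ.∣_∣ (sym (ℚ.neg-distrib-+ a (ℚ.- b)))) (ℚ.∣-p∣≡∣p∣ (a ℚ.- b))

_-_ : ℝ → ℝ → ℝ
x - y = x + (- y)

∣_∣ : ℝ → ℝ
∣ x ∣ = mkℝ (λ n → ℚ.∣ seq x n ∣) λ 0<ε →
  proj₁ (cauchy x 0<ε) , λ m n h k →
    ℚ.≤-<-trans (reverse-triangle (seq x m) (seq x n)) (proj₂ (cauchy x 0<ε) m n h k)
  where
  open ℚ.≤-Reasoning

  a-b+b : ∀ a b → (a ℚ.- b) ℚ.+ b ≡ a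
  a-b+b = solve 2 (λ a b → (a :- b) :+ b := a) refl
    where open +-*-Solver

  a+b-b : ∀ a b → (a ℚ.+ b) ℚ.- b ≡ a
  a+b-b = solve 2 (λ a b → (a :+ b) :- b := a) refl
    where open +-*-Solver

  -[a-b] : ∀ a b → ℚ.- (a ℚ.- b) ≡ b ℚ.- a
  -[a-b] = solve 2 (λ a b → :- (a :- b) := b :- a) refl
    where open +-*-Solver

  ∣a∣-∣b∣≤∣a-b∣ : ∀ a b → ℚ.∣ a ∣ ℚ.- ℚ.∣ b ∣ ℚ.≤ ℚ.∣ a ℚ.- b ∣
  ∣a∣-∣b∣≤∣a-b∣ a b = begin
    ℚ.∣ a ∣ ℚ.- ℚ.∣ b ∣
      ≡⟨ cong (λ c → ℚ.∣ c ∣ ℚ.- ℚ.∣ b ∣) (sym (a-b+b a b)) ⟩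
    ℚ.∣ (a ℚ.- b) ℚ.+ b ∣ ℚ.- ℚ.∣ b ∣
      ≤⟨ ℚ.+-monoˡ-≤ (ℚ.- ℚ.∣ b ∣) (ℚ.∣p+q∣≤∣p∣+∣q∣ (a ℚ.- b) b) ⟩
    (ℚ.∣ a ℚ.- b ∣ ℚ.+ ℚ.∣ b ∣) ℚ.- ℚ.∣ b ∣
      ≡⟨ a+b-b ℚ.∣ a ℚ.- b ∣ ℚ.∣ b ∣ ⟩
    ℚ.∣ a ℚ.- b ∣ ∎

  reverse-triangle : ∀ a b → ℚ.∣ ℚ.∣ a ∣ ℚ.- ℚ.∣ b ∣ ∣ ℚ.≤ ℚ.∣ a ℚ.- b ∣
  reverse-triangle a b with ℚ.∣p∣≡p∨∣p∣≡-p (ℚ.∣ a ∣ ℚ.- ℚ.∣ b ∣)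
  ... | inj₁ eq = subst (ℚ._≤ ℚ.∣ a ℚ.- b ∣) (sym eq) (∣a∣-∣b∣≤∣a-b∣ a b)
  ... | inj₂ eq = begin
    ℚ.∣ ℚ.∣ a ∣ ℚ.- ℚ.∣ b ∣ ∣  ≡⟨ trans eq (-[a-b] ℚ.∣ a ∣ ℚ.∣ b ∣) ⟩
    ℚ.∣ b ∣ ℚ.- ℚ.∣ a ∣        ≤⟨ ∣a∣-∣b∣≤∣a-b∣ b a ⟩
    ℚ.∣ b ℚ.- a ∣              ≡⟨ cong ℚ.∣_∣ (sym (-[a-b] a b)) ⟩
    ℚ.∣ ℚ.- (a ℚ.- b) ∣        ≡⟨ ℚ.∣-p∣≡∣p∣ (a ℚ.- b) ⟩
    ℚ.∣ a ℚ.- b ∣              ∎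

Irrational : ℝ → Set
Irrational x = ¬ (∃[ q ] x ≃ fromℚ q)

ConvergesTo : (ℕ → ℝ) → ℝ → Set
ConvergesTo s x = ∀ ε → 0ℝ < ε → ∃[ N ] ∀ n → N ℕ.≤ n → ∣ s n - x ∣ < ε

partialSum : (ℕ → ℝ) → ℕ → ℝ
partialSum f zero    = 0ℝ
partialSum f (suc n) = partialSum f n + f n

HasSum : (ℕ → ℝ) → ℝ → Set
HasSum f x = ConvergesTo (partialSum f) x

{-# OPTIONS --safe #-}

-- Clearing denominators as for e: if every term of a positive rational series is an
-- integer multiple of the next one, which is less than half of it, then the partial
-- sum S up to and including the term u lies in ℤu, while the remaining tail is
-- positive and less than u. So the sum misses ℤu. If moreover every rational lies in
-- some ℤu, the sum is irrational. For 1/pₙ! this uses only that the primes increase.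

module Submission where

open import Defs
open import Data.Product.Base using (∃-syntax; _×_; _,_; proj₁; proj₂)
open import Data.Integer.Base as ℤ using (ℤ; +_)
import Data.Integer.Properties as ℤ
open import Data.Nat.Base as ℕ using (ℕ; zero; suc; _!)
open import Data.Nat.Divisibility using (_∣_; divides; ∣⇒≤; m≤n⇒m!∣n!; m∣m*n; ∣-trans)
open import Data.Nat.Primality using (prime⇒nonTrivial)
import Data.Nat.Properties as ℕ
open import Data.Rational.Base as ℚ using (ℚ; mkℚ; 0ℚ; 1ℚ; ½; fromℚᵘ)
import Data.Rational.Properties as ℚ
open import Data.Rational.Solver using (module +-*-Solver)
open import Data.Rational.Unnormalised.Base as ℚᵘ using (mkℚᵘ; *≡*)
import Data.Rational.Unnormalised.Properties as ℚᵘ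
open import Data.Sum.Base using (inj₁; inj₂)
open import Relation.Binary.Definitions using (Reflexive; Transitive)
open import Relation.Binary.PropositionalEquality

private
  variable
    a b c ε q r u v : ℚ
    d D m n : ℕ

-- Inequalities in ℚ and monotone sequences.

x≤∣x∣ : ∀ x → x ℚ.≤ ℚ.∣ x ∣
x≤∣x∣ x with ℚ.≤-total 0ℚ x
... | inj₁ 0≤x = ℚ.≤-reflexive (sym (ℚ.0≤p⇒∣p∣≡p 0≤x))
... | inj₂ x≤0 = ℚ.≤-trans x≤0 (ℚ.0≤∣p∣ x)

-x≤∣x∣ : ∀ x → ℚ.- x ℚ.≤ ℚ.∣ x ∣
-x≤∣x∣ x = subst (ℚ.- x ℚ.≤_) (ℚ.∣-p∣≡∣p∣ x) (x≤∣x∣ (ℚ.- x))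

b≤a+c⇒b-a≤c : ∀ a b c → b ℚ.≤ a ℚ.+ c → b ℚ.- a ℚ.≤ c
b≤a+c⇒b-a≤c a b c b≤a+c = subst (b ℚ.- a ℚ.≤_) (a+c-a a c) (ℚ.+-monoˡ-≤ (ℚ.- a) b≤a+c)
  where
  open +-*-Solver
  a+c-a : ∀ a c → (a ℚ.+ c) ℚ.- a ≡ c
  a+c-a = solve 2 (λ a c → (a :+ c) :- a := c) refl

-[a-b]≡b-a : ∀ a b → ℚ.- (a ℚ.- b) ≡ b ℚ.- a
-[a-b]≡b-a = solve 2 (λ a b → :- (a :- b) := b :- a) refl
  where open +-*-Solver

a<b⇒0<b-a : a ℚ.< b → 0ℚ ℚ.< b ℚ.- a
a<b⇒0<b-a {a} {b} a<b = subst (ℚ._< b ℚ.- a) (ℚ.+-inverseʳ a) (ℚ.+-monoˡ-< (ℚ.- a) a<b)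

∣a-b∣≤ : a ℚ.≤ b ℚ.+ c → b ℚ.≤ a ℚ.+ c → ℚ.∣ a ℚ.- b ∣ ℚ.≤ c
∣a-b∣≤ {a} {b} {c} a≤b+c b≤a+c with ℚ.∣p∣≡p∨∣p∣≡-p (a ℚ.- b)
... | inj₁ eq = subst (ℚ._≤ c) (sym eq) (b≤a+c⇒b-a≤c b a c a≤b+c)
... | inj₂ eq = subst (ℚ._≤ c) (sym (trans eq (-[a-b]≡b-a a b))) (b≤a+c⇒b-a≤c a b c b≤a+c)

-- The relation is a parameter so that one induction serves both the increasing partial sums and the
-- decreasing upper bounds. `≤′` grows at its upper end, where `step` applies.
iterate-step : {_∼_ : ℚ → ℚ → Set} → Reflexive _∼_ → Transitive _∼_ →
  (f : ℕ → ℚ) → (∀ n → f n ∼ f (suc n)) → m ℕ.≤ n → f m ∼ f n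
iterate-step {_∼_ = _∼_} ∼-refl ∼-trans f step m≤n = go (ℕ.≤⇒≤′ m≤n)
  where
  go : m ℕ.≤′ n → f m ∼ f n
  go (ℕ.≤′-reflexive refl) = ∼-refl
  go (ℕ.≤′-step m≤′n)      = ∼-trans (go m≤′n) (step _)

-- Bounds on a rational limit.

module _ (x : ℝ) (x≃q : x ≃ fromℚ q) (N : ℕ) where

  -- If `q` were below `a`, the gap `a - q` could serve as tolerance; at an index past both `M` and
  -- `N` the distance to `q` would be at once at least this gap and less than it.
  limit-lowerBound : (∀ n → N ℕ.≤ n → a ℚ.≤ seq x n) → a ℚ.≤ q
  limit-lowerBound {a} a≤xₙ = ℚ.≮⇒≥ λ q<a →
    let M , close = x≃q (a ℚ.- q) (a<b⇒0<b-a q<a)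
        n         = M ℕ.⊔ N
    in ℚ.<-irrefl refl (begin-strict
      a ℚ.- q              ≤⟨ ℚ.+-monoˡ-≤ (ℚ.- q) (a≤xₙ n (ℕ.m≤n⊔m M N)) ⟩
      seq x n ℚ.- q        ≤⟨ x≤∣x∣ (seq x n ℚ.- q) ⟩
      ℚ.∣ seq x n ℚ.- q ∣  <⟨ close n (ℕ.m≤m⊔n M N) ⟩
      a ℚ.- q              ∎)
    where open ℚ.≤-Reasoning

  limit-upperBound : (∀ n → N ℕ.≤ n → seq x n ℚ.≤ a) → q ℚ.≤ a
  limit-upperBound {a} xₙ≤a = ℚ.≮⇒≥ λ a<q →
    let M , close = x≃q (q ℚ.- a) (a<b⇒0<b-a a<q)
        n         = M ℕ.⊔ N
    in ℚ.<-irrefl refl (begin-strict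
      q ℚ.- a              ≤⟨ ℚ.+-monoʳ-≤ q (ℚ.neg-antimono-≤ (xₙ≤a n (ℕ.m≤n⊔m M N))) ⟩
      q ℚ.- seq x n        ≡⟨ sym (-[a-b]≡b-a (seq x n) q) ⟩
      ℚ.- (seq x n ℚ.- q)  ≤⟨ -x≤∣x∣ (seq x n ℚ.- q) ⟩
      ℚ.∣ seq x n ℚ.- q ∣  <⟨ close n (ℕ.m≤m⊔n M N) ⟩
      q ℚ.- a              ∎)
    where open ℚ.≤-Reasoning

-- Real series with rational terms.

sum : (ℕ → ℚ) → ℕ → ℚ
sum f zero    = 0ℚ
sum f (suc n) = sum f n ℚ.+ f n

seq-partialSum : ∀ f n k → seq (partialSum (λ i → fromℚ (f i)) n) k ≡ sum f n
seq-partialSum f zero    k = refl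
seq-partialSum f (suc n) k = cong (ℚ._+ f n) (seq-partialSum f n k)

-- Each real partial sum is a constant sequence, so its distance to the limit at index `k` is a
-- difference of two rational sums. Half of `δ` bounds that difference; the other half is the
-- uniform margin that `<` on reals demands.
hasSum : ∀ f (cauchy : IsCauchy (sum f)) → HasSum (λ i → fromℚ (f i)) (mkℝ (sum f) cauchy)
hasSum f cauchy ε (δ , 0<δ , M , δ<εₖ) =
  proj₁ tail , λ n N≤n → ½ ℚ.* δ , 0<½δ , M ℕ.⊔ proj₁ tail , λ k h → begin-strict
    ℚ.∣ seq (partialSum (λ i → fromℚ (f i)) n) k ℚ.- sum f k ∣ ℚ.+ ½ ℚ.* δ
      ≡⟨ cong (λ s → ℚ.∣ s ℚ.- sum f k ∣ ℚ.+ ½ ℚ.* δ) (seq-partialSum f n k) ⟩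
    ℚ.∣ sum f n ℚ.- sum f k ∣ ℚ.+ ½ ℚ.* δ
      <⟨ ℚ.+-monoˡ-< (½ ℚ.* δ)
           (proj₂ tail n k N≤n (ℕ.m⊔n≤o⇒n≤o M (proj₁ tail) h)) ⟩
    ½ ℚ.* δ ℚ.+ ½ ℚ.* δ
      ≡⟨ trans (sym (ℚ.*-distribʳ-+ δ ½ ½)) (ℚ.*-identityˡ δ) ⟩
    δ
      ≡⟨ sym (ℚ.+-identityˡ δ) ⟩
    0ℚ ℚ.+ δ
      <⟨ δ<εₖ k (ℕ.m⊔n≤o⇒m≤o M (proj₁ tail) h) ⟩
    seq ε k ∎
  where
  open ℚ.≤-Reasoning
  0<½δ : 0ℚ ℚ.< ½ ℚ.* δ
  0<½δ = subst (ℚ._< ½ ℚ.* δ) (ℚ.*-zeroʳ ½) (ℚ.*-monoʳ-<-pos ½ 0<δ)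
  tail = cauchy 0<½δ

-- Fractions and the embedding of ℤ into ℚ.

fromℚᵘ-mono-≤ : ∀ x y → x ℚᵘ.≤ y → fromℚᵘ x ℚ.≤ fromℚᵘ y
fromℚᵘ-mono-≤ x y x≤y = ℚ.toℚᵘ-cancel-≤
  (ℚᵘ.≤-respˡ-≃ (ℚᵘ.≃-sym (ℚ.toℚᵘ-fromℚᵘ x)) (ℚᵘ.≤-respʳ-≃ (ℚᵘ.≃-sym (ℚ.toℚᵘ-fromℚᵘ y)) x≤y))

fromℚᵘ-mono-< : ∀ x y → x ℚᵘ.< y → fromℚᵘ x ℚ.< fromℚᵘ y
fromℚᵘ-mono-< x y x<y = ℚ.toℚᵘ-cancel-<
  (ℚᵘ.<-respˡ-≃ (ℚᵘ.≃-sym (ℚ.toℚᵘ-fromℚᵘ x)) (ℚᵘ.<-respʳ-≃ (ℚᵘ.≃-sym (ℚ.toℚᵘ-fromℚᵘ y)) x<y))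

fromℤ : ℤ → ℚ
fromℤ i = i ℚ./ 1

fromℤ-+ : ∀ i j → fromℤ (i ℤ.+ j) ≡ fromℤ i ℚ.+ fromℤ j
fromℤ-+ i j = ℚ.toℚᵘ-injective (begin
  ℚ.toℚᵘ (fromℤ (i ℤ.+ j))                    ≈⟨ ℚ.toℚᵘ-fromℚᵘ (mkℚᵘ (i ℤ.+ j) 0) ⟩
  mkℚᵘ (i ℤ.+ j) 0                            ≈⟨ *≡* (cong (ℤ._* + 1)
                                                   (sym (cong₂ ℤ._+_ (ℤ.*-identityʳ i) (ℤ.*-identityʳ j)))) ⟩
  mkℚᵘ i 0 ℚᵘ.+ mkℚᵘ j 0                      ≈⟨ ℚᵘ.+-cong (ℚ.toℚᵘ-fromℚᵘ (mkℚᵘ i 0)) (ℚ.toℚᵘ-fromℚᵘ (mkℚᵘ j 0)) ⟨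
  ℚ.toℚᵘ (fromℤ i) ℚᵘ.+ ℚ.toℚᵘ (fromℤ j)      ≈⟨ ℚ.toℚᵘ-homo-+ (fromℤ i) (fromℤ j) ⟨
  ℚ.toℚᵘ (fromℤ i ℚ.+ fromℤ j)                ∎)
  where open ℚᵘ.≃-Reasoning

-- Once the denominators are successors, each quotient is by computation `fromℚᵘ` of an unnormalised
-- fraction, and those multiply without cancellation.
/-* : ∀ i j m n .{{_ : ℕ.NonZero m}} .{{_ : ℕ.NonZero n}} .{{_ : ℕ.NonZero (m ℕ.* n)}} →
  (i ℚ./ m) ℚ.* (j ℚ./ n) ≡ (i ℤ.* j) ℚ./ (m ℕ.* n)
/-* i j (suc m) (suc n) = ℚ.toℚᵘ-injective (begin
  ℚ.toℚᵘ (fromℚᵘ x ℚ.* fromℚᵘ y)              ≈⟨ ℚ.toℚᵘ-homo-* (fromℚᵘ x) (fromℚᵘ y) ⟩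
  ℚ.toℚᵘ (fromℚᵘ x) ℚᵘ.* ℚ.toℚᵘ (fromℚᵘ y)    ≈⟨ ℚᵘ.*-cong (ℚ.toℚᵘ-fromℚᵘ x) (ℚ.toℚᵘ-fromℚᵘ y) ⟩
  x ℚᵘ.* y                                    ≈⟨ ℚ.toℚᵘ-fromℚᵘ (x ℚᵘ.* y) ⟨
  ℚ.toℚᵘ (fromℚᵘ (x ℚᵘ.* y))                  ∎)
  where
  open ℚᵘ.≃-Reasoning
  x = mkℚᵘ i m
  y = mkℚᵘ j n

fromℤ-* : ∀ i j → fromℤ (i ℤ.* j) ≡ fromℤ i ℚ.* fromℤ j
fromℤ-* i j = sym (/-* i j 1 1)

fromℤ-mono-≤ : ∀ {i j} → i ℤ.≤ j → fromℤ i ℚ.≤ fromℤ j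
fromℤ-mono-≤ {i} {j} i≤j = fromℚᵘ-mono-≤ (mkℚᵘ i 0) (mkℚᵘ j 0) (ℚᵘ.*≤* (ℤ.*-monoʳ-≤-nonNeg (+ 1) i≤j))

fromℤ-cancel-< : ∀ {i j} → fromℤ i ℚ.< fromℤ j → i ℤ.< j
fromℤ-cancel-< i<j = ℤ.≰⇒> λ j≤i → ℚ.<-irrefl refl (ℚ.<-≤-trans i<j (fromℤ-mono-≤ j≤i))

-- The cyclic subgroups ℤu of ℚ.

infix 4 _∈ℤ_

_∈ℤ_ : ℚ → ℚ → Set
q ∈ℤ u = ∃[ i ] q ≡ fromℤ i ℚ.* u

0∈ℤ : 0ℚ ∈ℤ u
0∈ℤ {u} = + 0 , sym (ℚ.*-zeroˡ u)

∈ℤ-refl : u ∈ℤ u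
∈ℤ-refl {u} = + 1 , sym (ℚ.*-identityˡ u)

∈ℤ-+ : q ∈ℤ u → r ∈ℤ u → q ℚ.+ r ∈ℤ u
∈ℤ-+ {u = u} (i , refl) (j , refl) = i ℤ.+ j ,
  sym (trans (cong (ℚ._* u) (fromℤ-+ i j)) (ℚ.*-distribʳ-+ u (fromℤ i) (fromℤ j)))

∈ℤ-trans : q ∈ℤ u → u ∈ℤ v → q ∈ℤ v
∈ℤ-trans {v = v} (i , refl) (j , refl) = i ℤ.* j ,
  sym (trans (cong (ℚ._* v) (fromℤ-* i j)) (ℚ.*-assoc (fromℤ i) (fromℤ j) v))

-- Cancelling the positive `u` turns this into the discreteness of ℤ.
∈ℤ-gap : 0ℚ ℚ.< u → q ∈ℤ u → r ∈ℤ u → q ℚ.< r → q ℚ.+ u ℚ.≤ r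
∈ℤ-gap {u} 0<u (i , refl) (j , refl) q<r = begin
  fromℤ i ℚ.* u ℚ.+ u              ≡⟨ ℚ.+-comm (fromℤ i ℚ.* u) u ⟩
  u ℚ.+ fromℤ i ℚ.* u              ≡⟨ cong (ℚ._+ fromℤ i ℚ.* u) (sym (ℚ.*-identityˡ u)) ⟩
  1ℚ ℚ.* u ℚ.+ fromℤ i ℚ.* u       ≡⟨ sym (ℚ.*-distribʳ-+ u 1ℚ (fromℤ i)) ⟩
  (1ℚ ℚ.+ fromℤ i) ℚ.* u           ≡⟨ cong (ℚ._* u) (sym (fromℤ-+ (+ 1) i)) ⟩
  fromℤ (ℤ.suc i) ℚ.* u            ≤⟨ ℚ.*-monoʳ-≤-nonNeg u (fromℤ-mono-≤ (ℤ.i<j⇒suc[i]≤j i<j)) ⟩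
  fromℤ j ℚ.* u                    ∎
  where
  open ℚ.≤-Reasoning
  instance
    u-nonNeg : ℚ.NonNegative u
    u-nonNeg = ℚ.nonNegative (ℚ.<⇒≤ 0<u)
  i<j : i ℤ.< j
  i<j = fromℤ-cancel-< (ℚ.*-cancelʳ-<-nonNeg u q<r)

-- Series over a refining scale.

record IsRefiningScale (u : ℕ → ℚ) : Set where
  field
    positive  : ∀ n → 0ℚ ℚ.< u n
    halving   : ∀ n → u (suc n) ℚ.+ u (suc n) ℚ.< u n
    -- Together with `exhausts`: the groups ℤ(u n) form an increasing chain with union ℚ.
    multiple  : ∀ n → u n ∈ℤ u (suc n)
    exhausts  : ∀ q → ∃[ n ] q ∈ℤ u n

module Series {u : ℕ → ℚ} (isRefiningScale : IsRefiningScale u) where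
  open IsRefiningScale isRefiningScale

  S : ℕ → ℚ
  S = sum u

  S-step : ∀ n → S n ℚ.< S (suc n)
  S-step n = subst (ℚ._< S (suc n)) (ℚ.+-identityʳ (S n)) (ℚ.+-monoʳ-< (S n) (positive n))

  S-mono : m ℕ.≤ n → S m ℚ.≤ S n
  S-mono = iterate-step {_∼_ = ℚ._≤_} ℚ.≤-refl ℚ.≤-trans S (λ n → ℚ.<⇒≤ (S-step n))

  -- By halving, the tail starting at `u n` is dominated by the geometric series with sum
  -- `u n + u n`.
  bound : ℕ → ℚ
  bound n = S n ℚ.+ (u n ℚ.+ u n)

  bound-step : ∀ n → bound (suc n) ℚ.≤ bound n
  bound-step n = subst (bound (suc n) ℚ.≤_) (ℚ.+-assoc (S n) (u n) (u n))
    (ℚ.+-monoʳ-≤ (S (suc n)) (ℚ.<⇒≤ (halving n)))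

  S≤bound : m ℕ.≤ n → S n ℚ.≤ bound m
  S≤bound {n = n} m≤n = ℚ.≤-trans
    (subst (ℚ._≤ bound n) (ℚ.+-identityʳ (S n))
      (ℚ.+-monoʳ-≤ (S n) (ℚ.+-mono-≤ (ℚ.<⇒≤ (positive n)) (ℚ.<⇒≤ (positive n)))))
    (iterate-step {_∼_ = ℚ._≥_} ℚ.≤-refl (λ p q → ℚ.≤-trans q p) bound bound-step m≤n)

  -- Exhaustion plays the part of the Archimedean property: a positive `ε` in some ℤ(u N) is at
  -- least `u N`, and one more halving gets strictly below it.
  eventually-below : 0ℚ ℚ.< ε → ∃[ N ] u N ℚ.+ u N ℚ.< ε
  eventually-below {ε} 0<ε with exhausts ε
  ... | N , ε∈ℤuN = suc N , ℚ.<-≤-trans (halving N)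
    (subst (ℚ._≤ ε) (ℚ.+-identityˡ (u N)) (∈ℤ-gap (positive N) 0∈ℤ ε∈ℤuN 0<ε))

  S-cauchy : IsCauchy S
  S-cauchy 0<ε with eventually-below 0<ε
  ... | N , 2uN<ε = N , λ m n N≤m N≤n →
    ℚ.≤-<-trans (∣a-b∣≤ (close N≤m N≤n) (close N≤n N≤m)) 2uN<ε
    where
    close : N ℕ.≤ m → N ℕ.≤ n → S m ℚ.≤ S n ℚ.+ (u N ℚ.+ u N)
    -- Both sums are compared with `S N`: `S m` exceeds it by at most `u N + u N`, and `S n` is no
    -- smaller.
    close N≤m N≤n = ℚ.≤-trans (S≤bound N≤m) (ℚ.+-monoˡ-≤ (u N ℚ.+ u N) (S-mono N≤n))

  limit : ℝ
  limit = mkℝ S S-cauchy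

  S[1+n]∈ℤu[n] : ∀ n → S (suc n) ∈ℤ u n
  S[1+n]∈ℤu[n] zero    = ∈ℤ-+ 0∈ℤ ∈ℤ-refl
  S[1+n]∈ℤu[n] (suc n) = ∈ℤ-+ (∈ℤ-trans (S[1+n]∈ℤu[n] n) (multiple n)) ∈ℤ-refl

  -- A rational limit `q` shares some ℤ(u n) with `S (suc n)` and exceeds it, hence by at least
  -- `u n`; yet the tail is at most `u (suc n) + u (suc n)`, strictly less than `u n`.
  limit-irrational : Irrational limit
  limit-irrational (q , limit≃q) with exhausts q
  ... | n , q∈ℤu = ℚ.<-irrefl refl (begin-strict
    S (suc n) ℚ.+ u n  ≤⟨ ∈ℤ-gap (positive n) (S[1+n]∈ℤu[n] n) q∈ℤu S<q ⟩
    q                  ≤⟨ limit-upperBound limit limit≃q (suc n) (λ _ → S≤bound) ⟩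
    bound (suc n)      <⟨ ℚ.+-monoʳ-< (S (suc n)) (halving n) ⟩
    S (suc n) ℚ.+ u n  ∎)
    where
    open ℚ.≤-Reasoning
    S<q : S (suc n) ℚ.< q
    -- Limits preserve only weak inequalities, so strictness comes from adding one further term
    -- first.
    S<q = ℚ.<-≤-trans (S-step (suc n))
      (limit-lowerBound limit limit≃q (suc (suc n)) (λ _ → S-mono))

-- Divisibility and size of unit fractions.

/-∈ℤ : ∀ i .{{_ : ℕ.NonZero d}} .{{_ : ℕ.NonZero D}} → d ∣ D → i ℚ./ d ∈ℤ (+ 1) ℚ./ D
/-∈ℤ {suc d} {D@(suc D-1)} i (divides k D≡k*d) = i ℤ.* + k , (begin
  -- The fraction is expanded by the cofactor `k` to denominator `D`.
  i ℚ./ suc d                                ≡⟨ ℚ.fromℚᵘ-cong {mkℚᵘ i d} {mkℚᵘ (i ℤ.* + k) D-1} (*≡* cross) ⟩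
  (i ℤ.* + k) ℚ./ D                          ≡⟨ ℚ./-cong (sym (ℤ.*-identityʳ (i ℤ.* + k))) (sym (ℕ.*-identityˡ D)) ⟩
  (i ℤ.* + k ℤ.* + 1) ℚ./ (1 ℕ.* D)          ≡⟨ sym (/-* (i ℤ.* + k) (+ 1) 1 D) ⟩
  fromℤ (i ℤ.* + k) ℚ.* ((+ 1) ℚ./ D)        ∎)
  where
  open ≡-Reasoning
  cross : i ℤ.* + D ≡ i ℤ.* + k ℤ.* + suc d
  cross = trans (cong (i ℤ.*_) (trans (cong +_ D≡k*d) (ℤ.pos-* k (suc d))))
                (sym (ℤ.*-assoc i (+ k) (+ suc d)))

0<1/ : ∀ n .{{_ : ℕ.NonZero n}} → 0ℚ ℚ.< (+ 1) ℚ./ n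
0<1/ n = ℚ.positive⁻¹ ((+ 1) ℚ./ n) {{ℚ.normalize-pos 1 n}}

1/-halving : .{{_ : ℕ.NonZero d}} .{{_ : ℕ.NonZero D}} → 2 ℕ.* d ℕ.< D →
  (+ 1) ℚ./ D ℚ.+ (+ 1) ℚ./ D ℚ.< (+ 1) ℚ./ d
1/-halving {suc d} {D@(suc D-1)} 2d<D = begin-strict
  w ℚ.+ w                        ≡⟨ sym (cong₂ ℚ._+_ (ℚ.*-identityˡ w) (ℚ.*-identityˡ w)) ⟩
  1ℚ ℚ.* w ℚ.+ 1ℚ ℚ.* w          ≡⟨ sym (ℚ.*-distribʳ-+ w 1ℚ 1ℚ) ⟩
  fromℤ (+ 2) ℚ.* w              ≡⟨ /-* (+ 2) (+ 1) 1 D ⟩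
  (+ 2) ℚ./ (1 ℕ.* D)            ≡⟨ ℚ./-cong {+ 2} refl (ℕ.*-identityˡ D) ⟩
  (+ 2) ℚ./ D                    <⟨ fromℚᵘ-mono-< (mkℚᵘ (+ 2) D-1) (mkℚᵘ (+ 1) d) (ℚᵘ.*<* cross) ⟩
  (+ 1) ℚ./ suc d                ∎
  where
  open ℚ.≤-Reasoning
  w = (+ 1) ℚ./ D
  cross : + 2 ℤ.* + suc d ℤ.< + 1 ℤ.* + D
  cross = subst₂ ℤ._<_ (ℤ.pos-* 2 (suc d)) (sym (ℤ.*-identityˡ (+ D))) (ℤ.+<+ 2d<D)

-- Reciprocal factorials along an increasing sequence.

module Factorials (a : ℕ → ℕ) (2≤a₀ : 2 ℕ.≤ a 0) (a-step : ∀ n → a n ℕ.< a (suc n)) where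

  -- Used twice: `a n` is at least 2, which drives the halving, and `a n` is at least `n`, which
  -- lets the factorials absorb every denominator.
  2+n≤a : ∀ n → 2 ℕ.+ n ℕ.≤ a n
  2+n≤a zero    = 2≤a₀
  2+n≤a (suc n) = ℕ.≤-trans (ℕ.s≤s (2+n≤a n)) (a-step n)

  -- The larger factorial is a multiple of `(1 + a n) !`, whose leading factor is more than 2.
  2*a!<a! : ∀ n → 2 ℕ.* a n ! ℕ.< a (suc n) !
  2*a!<a! n = ℕ.<-≤-trans
    (ℕ.*-monoˡ-< (a n !) {{a n ℕ.!≢0}} (ℕ.s≤s (ℕ.m+n≤o⇒m≤o 2 (2+n≤a n))))
    (∣⇒≤ {{a (suc n) ℕ.!≢0}} (m≤n⇒m!∣n! (a-step n)))

  isRefiningScale : IsRefiningScale (λ n → 1/ a n !)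
  isRefiningScale = record
    { positive = λ n → 0<1/ (a n !) {{a n ℕ.!≢0}}
    ; halving  = λ n → 1/-halving {{a n ℕ.!≢0}} {{a (suc n) ℕ.!≢0}} (2*a!<a! n)
    ; multiple = λ n → /-∈ℤ (+ 1) {{a n ℕ.!≢0}} {{a (suc n) ℕ.!≢0}} (m≤n⇒m!∣n! (ℕ.<⇒≤ (a-step n)))
    -- The denominator itself works as index: `a d` is at least `d`, so `d` divides `a d !`.
    ; exhausts = λ q → ℚ.↧ₙ q , subst (_∈ℤ (1/ a (ℚ.↧ₙ q) !)) (ℚ.↥p/↧p≡p q)
        (/-∈ℤ (ℚ.↥ q) {{_}} {{a (ℚ.↧ₙ q) ℕ.!≢0}} (denominator∣a! q))
    }
    where
    denominator∣a! : ∀ q → ℚ.↧ₙ q ∣ a (ℚ.↧ₙ q) !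
    denominator∣a! (mkℚ _ d _) =
      ∣-trans (m∣m*n (d !)) (m≤n⇒m!∣n! (ℕ.m+n≤o⇒n≤o 2 (2+n≤a (suc d))))

theorem65 : ∃[ x ] HasSum (λ n → fromℚ (1/ nthPrime n !)) x × Irrational x
theorem65 = limit , hasSum _ S-cauchy , limit-irrational
  where
  2≤nthPrime[0] : 2 ℕ.≤ nthPrime 0
  2≤nthPrime[0] = ℕ.nonTrivial⇒n>1 (nthPrime 0)
    {{prime⇒nonTrivial (proj₁ (proj₂ (proj₂ (nextPrime 0))))}}
  open Factorials nthPrime 2≤nthPrime[0] (λ n → proj₁ (proj₂ (nextPrime (nthPrime n))))
  open Series isRefiningScale
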